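{- For a graph $G$ and an integer $r\geq 1$, $\mathrm{tw}_r(G)\leq \mathrm{sn}_r(G)\leq \mathrm{gon}_r(G)$.
   Context: A graph is a finite, connected, undirected multigraph without loops. A vertex set $A$ is $r$-edge-connected if $G[A]$ remains connected after deleting any $r-1$ edges (a single vertex counts). A multiset $C$ of vertices $r$-intersects a set $A$ if at least $r$ elements of $C$, counted with multiplicity, lie in $A$; for a collection $\mathcal{F}$ of vertex sets, $h_r(\mathcal F)$ is the minimum size of a multiset $r$-intersecting every member. An $r$-bramble is a collection $\mathcal B$ of $r$-edge-connected vertex subsets such that any two $B,B'\in\mathcal B$ either intersect or have at least $r$ edges between them; its order is $h_r(\mathcal B)$, $\mathrm{bn}_r(G)$ is the maximum order of an $r$-bramble, and $\mathrm{tw}_r(G)=\mathrm{bn}_r(G)-r$. An $r$-scramble is a collection of nonempty $r$-edge-connected vertex subsets (eggs); $e(\mathcal S)$ is the minimum number of edges whose deletion disconnects $G$ into components at least two of which contain an egg; its order is $\min\{h_r(\mathcal S),e(\mathcal S)\}$, and $\mathrm{sn}_r(G)$ is the maximum order of an $r$-scramble. A divisor is $D=\sum_v D(v)(v)$, $\deg D=\sum D(v)$, effective if all $D(v)\ge0$; firing $v$ gives $D'(v)=D(v)-\mathrm{val}(v)$, $D'(w)=D(w)+(\#\text{edges }vw)$; linear equivalence is generated by firings; $r(D)=-1$ if $D$ is not equivalent to an effective divisor, else the largest $r\ge0$ with $D-E$ equivalent to an effective divisor for every effective $E$ of degree $r$. $\mathrm{gon}_r(G)$ is the minimum degree of a divisor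 of rank at least $r$. -}

module Defs where

open import Data.Nat as ℕ using (ℕ; zero; suc; _+_; _*_; _∸_; _≤_; _<_)
open import Data.Integer as ℤ using (ℤ; +_)
open import Data.Fin using (Fin; zero; suc; toℕ; _≟_)
open import Data.Bool using (Bool; true; false; if_then_else_)
open import Data.List using (List)
open import Data.List.Membership.Propositional using (_∈_)
open import Data.Product using (Σ; ∃; _×_; _,_)
open import Data.Sum using (_⊎_)
open import Relation.Nullary using (¬_; yes; no)
open import Relation.Binary.PropositionalEquality using (_≡_)

sumℕ : ∀ {n} → (Fin n → ℕ) → ℕ
sumℕ {zero}  f = 0
sumℕ {suc n} f = f zero + sumℕ (λ i → f (suc i))

sumℤ : ∀ {n} → (Fin n → ℤ) → ℤ
sumℤ {zero}  f = + 0
sumℤ {suc n} f = f zero ℤ.+ sumℤ (λ i → f (suc i))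

VSet : ℕ → Set
VSet n = Fin n → Bool

Mult : ℕ → Set
Mult n = Fin n → Fin n → ℕ

data Reach {n : ℕ} (A : VSet n) (m : Mult n) : Fin n → Fin n → Set where
  here : ∀ {u} → Reach A m u u
  step : ∀ {u w v} → A w ≡ true → 0 < m u w → Reach A m w v → Reach A m u v

allV : ∀ {n} → VSet n
allV _ = true

record Graph : Set where
  field
    n         : ℕ
    nonempty  : 1 ≤ n
    mult      : Mult n
    symmetric : ∀ u v → mult u v ≡ mult v u
    loopless  : ∀ v → mult v v ≡ 0
    connected : ∀ u v → Reach allV mult u v

module _ (G : Graph) where
  open Graph G

  V : Set
  V = Fin n

  record Deletion : Set where
    field
      del     : Mult n
      del-sym : ∀ u v → del u v ≡ del v u
      del-≤   : ∀ u v → del u v ≤ mult u v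

  -- number of deleted edges (each edge counted once: pairs u < v)
  delCount : Deletion → ℕ
  delCount d = sumℕ (λ u → sumℕ (λ v →
    if toℕ u ℕ.<ᵇ toℕ v then Deletion.del d u v else 0))

  remaining : Deletion → Mult n
  remaining d u v = mult u v ∸ Deletion.del d u v

  REdgeConnected : ℕ → VSet n → Set
  REdgeConnected r A = (d : Deletion) → delCount d ≤ r ∸ 1 →
    ∀ u v → A u ≡ true → A v ≡ true → Reach A (remaining d) u v

  NonemptySet : VSet n → Set
  NonemptySet A = ∃ λ v → A v ≡ true

  MSet : Set
  MSet = Fin n → ℕ

  msize : MSet → ℕ
  msize C = sumℕ C

  countIn : MSet → VSet n → ℕ
  countIn C A = sumℕ (λ v → if A v then C v else 0)

  RIntersects : ℕ → MSet → VSet n → Set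
  RIntersects r C A = r ≤ countIn C A

  RIntersectsAll : ℕ → MSet → List (VSet n) → Set
  RIntersectsAll r C F = ∀ A → A ∈ F → RIntersects r C A

  HrIs : ℕ → List (VSet n) → ℕ → Set
  HrIs r F k = (∃ λ C → RIntersectsAll r C F × msize C ≡ k)
             × (∀ C → RIntersectsAll r C F → k ≤ msize C)

  edgesBetween : VSet n → VSet n → ℕ
  edgesBetween A B = sumℕ (λ u → sumℕ (λ v →
    if A u then (if B v then mult u v else 0) else 0))

  Touch : ℕ → VSet n → VSet n → Set
  Touch r A B = (∃ λ v → A v ≡ true × B v ≡ true) ⊎ r ≤ edgesBetween A B

  IsBramble : ℕ → List (VSet n) → Set
  IsBramble r B = (∀ A → A ∈ B → NonemptySet A × REdgeConnected r A)
                × (∀ A A' → A ∈ B → A' ∈ B → Touch r A A')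

  BnIs : ℕ → ℕ → Set
  BnIs r b = (∃ λ B → IsBramble r B × HrIs r B b)
           × (∀ B k → IsBramble r B → HrIs r B k → k ≤ b)

  IsScramble : ℕ → List (VSet n) → Set
  IsScramble r S = ∀ A → A ∈ S → NonemptySet A × REdgeConnected r A

  -- the deletion d disconnects G into components, two different ones of
  -- which each contain (entirely) an egg
  IsEggCut : List (VSet n) → Deletion → Set
  IsEggCut S d = ∃ λ A → ∃ λ B → A ∈ S × B ∈ S × ∃ λ a → ∃ λ b →
      A a ≡ true × B b ≡ true
    × (∀ x → A x ≡ true → Reach allV (remaining d) a x)
    × (∀ y → B y ≡ true → Reach allV (remaining d) b y)
    × ¬ Reach allV (remaining d) a b

  -- order of S is k, i.e. k = min(h_r(S), e(S)), where e(S) = ∞ if no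
  -- egg-cut exists: k is the minimum of all sizes of r-intersecting
  -- multisets and all sizes of egg-cuts
  ScrambleOrderIs : ℕ → List (VSet n) → ℕ → Set
  ScrambleOrderIs r S k =
      ((∃ λ C → RIntersectsAll r C S × msize C ≡ k)
        ⊎ (∃ λ d → IsEggCut S d × delCount d ≡ k))
    × (∀ C → RIntersectsAll r C S → k ≤ msize C)
    × (∀ d → IsEggCut S d → k ≤ delCount d)

  SnIs : ℕ → ℕ → Set
  SnIs r s = (∃ λ S → IsScramble r S × ScrambleOrderIs r S s)
           × (∀ S k → IsScramble r S → ScrambleOrderIs r S k → k ≤ s)

  Divisor : Set
  Divisor = Fin n → ℤ

  deg : Divisor → ℤ
  deg D = sumℤ D

  Effective : Divisor → Set
  Effective D = ∀ v → + 0 ℤ.≤ D v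

  val : Fin n → ℕ
  val v = sumℕ (mult v)

  fire : Fin n → Divisor → Divisor
  fire v D w with v ≟ w
  ... | yes _ = D w ℤ.- + val v
  ... | no  _ = D w ℤ.+ + mult v w

  -- linear equivalence: the equivalence relation generated by firings
  -- (divisors compared pointwise)
  data _∼_ (D : Divisor) : Divisor → Set where
    ∼base   : ∀ {D'} → (∀ w → D w ≡ D' w) → D ∼ D'
    ∼fire   : ∀ {D' D''} v → D ∼ D' → (∀ w → D'' w ≡ fire v D' w) → D ∼ D''
    ∼unfire : ∀ {D' D''} v → D ∼ D' → (∀ w → D' w ≡ fire v D'' w) → D ∼ D''
    ∼trans  : ∀ {D' D''} → D ∼ D' → D' ∼ D'' → D ∼ D''

  EquivEffective : Divisor → Set
  EquivEffective D = ∃ λ F → Effective F × D ∼ F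

  -- D - E is equivalent to an effective divisor for every effective E of
  -- degree k (effective divisors E given as ℕ-valued functions)
  RankProperty : Divisor → ℕ → Set
  RankProperty D k = (E : Fin n → ℕ) → sumℕ E ≡ k →
    EquivEffective (λ v → D v ℤ.- + E v)

  -- r(D) ≥ r (for r ≥ 0): D is equivalent to an effective divisor and the
  -- largest k with the rank property is at least r
  RankAtLeast : Divisor → ℕ → Set
  RankAtLeast D r = EquivEffective D × ∃ λ k → r ≤ k × RankProperty D k

  GonIs : ℕ → ℤ → Set
  GonIs r g = (∃ λ D → RankAtLeast D r × deg D ≡ g)
            × (∀ D → RankAtLeast D r → g ℤ.≤ deg D)

{-# OPTIONS --safe #-}
-- Lower bound: if an egg cut of a bramble ℬ leaves A inside a component X and B outside, take a
-- set F of cut edges, minimal with every member of ℬ inside X meeting at least r edges of F; by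
-- minimality some member E₀ inside X meets only r. The X-ends of F, the other ends of the
-- remaining cut edges, and the other ends of the F-edges at E₀ together r-intersect all of ℬ,
-- so the order of ℬ exceeds the size of the cut by at most r.
--
-- Upper bound: move an effective divisor through its class so that it r-intersects more and more
-- eggs. One passes between two effective divisors of a class by firing an increasing chain of
-- vertex sets, with all intermediate divisors effective. If making an egg A r-intersected costs
-- another egg B, then one of these sets contains B and is disjoint from A, and its boundary has
-- at most as many edges as the divisor has chips.
module Submission where

open import Defs
open import Data.Nat using (ℕ; _≤_)
open import Data.Integer using (ℤ; +_; _-_) renaming (_≤_ to _≤ℤ_)
open import Data.Product using (_×_)

open import Data.Nat using (zero; suc; _+_; _*_; _∸_; _<_; z≤n; s≤s; _<ᵇ_; _≤?_; _<?_)
open import Data.Nat.Properties hiding (_≟_)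
import Data.Integer as ℤ
import Data.Integer.Properties as ℤ
import Data.Integer.Tactic.RingSolver as ℤ-Solver
import Algebra.Properties.AbelianGroup ℤ.+-0-abelianGroup as ℤ-Group
open import Algebra.Properties.CommutativeSemigroup +-commutativeSemigroup
  using (interchange; x∙yz≈y∙xz; x∙yz≈xz∙y; xy∙z≈xz∙y)
open import Data.Bool as Bool using (Bool; true; false; if_then_else_; not; _∧_; _∨_; T)
open import Data.Bool.Properties using (¬-not; not-injective; ∨-comm)
open import Data.Empty using (⊥; ⊥-elim)
open import Data.Fin using (Fin; zero; suc; toℕ; _≟_)
open import Data.Fin.Properties using (toℕ-injective; any?)
open import Data.List using (List; []; _∷_; filter)
open import Data.List.Membership.Propositional using (_∈_; find; lose)
open import Data.List.Membership.Propositional.Properties using (∈-filter⁺; ∈-filter⁻)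
import Data.List.Relation.Unary.Any as Any
open import Data.List.Relation.Unary.Any using (here; there)
open import Data.Product using (∃; _,_; proj₁; proj₂)
open import Data.Sum using (_⊎_; inj₁; inj₂; map₂)
open import Function using (flip)
open import Relation.Binary.PropositionalEquality
open import Relation.Nullary using (¬_; yes; no; Dec; does)
open import Relation.Nullary.Decidable
  using (_×-dec_; dec-true; dec-false; decidable-stable; ¬¬-excluded-middle)

-- Finite sums

true≢false : ∀ {b} → b ≡ true → b ≡ false → ⊥
true≢false refl ()

∧-true : ∀ {a b} → a ∧ b ≡ true → a ≡ true × b ≡ true
∧-true {true} p = refl , p

∧-intro : ∀ {a b} → a ≡ true → b ≡ true → a ∧ b ≡ true
∧-intro refl p = p

sum-cong : ∀ {n} {f g : Fin n → ℕ} → (∀ i → f i ≡ g i) → sumℕ f ≡ sumℕ g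
sum-cong {zero}  h = refl
sum-cong {suc n} h = cong₂ _+_ (h zero) (sum-cong (λ i → h (suc i)))

sum-mono : ∀ {n} {f g : Fin n → ℕ} → (∀ i → f i ≤ g i) → sumℕ f ≤ sumℕ g
sum-mono {zero}  h = z≤n
sum-mono {suc n} h = +-mono-≤ (h zero) (sum-mono (λ i → h (suc i)))

sum-0 : ∀ n → sumℕ {n} (λ _ → 0) ≡ 0
sum-0 zero    = refl
sum-0 (suc n) = sum-0 n

sum-+ : ∀ {n} (f g : Fin n → ℕ) → sumℕ (λ i → f i + g i) ≡ sumℕ f + sumℕ g
sum-+ {zero}  f g = refl
sum-+ {suc n} f g = trans
  (cong (_+_ (f zero + g zero)) (sum-+ (λ i → f (suc i)) (λ i → g (suc i))))
  (interchange (f zero) (g zero) _ _)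

sum-*ʳ : ∀ {n} (f : Fin n → ℕ) c → sumℕ (λ i → f i * c) ≡ sumℕ f * c
sum-*ʳ {zero}  f c = refl
sum-*ʳ {suc n} f c = trans (cong (_+_ (f zero * c)) (sum-*ʳ (λ i → f (suc i)) c))
                           (sym (*-distribʳ-+ c (f zero) _))

sum-swap : ∀ {m n} (f : Fin m → Fin n → ℕ) →
  sumℕ (λ i → sumℕ (f i)) ≡ sumℕ (λ j → sumℕ (λ i → f i j))
sum-swap {zero}  {n} f = sym (sum-0 n)
sum-swap {suc m} f = trans (cong (_+_ (sumℕ (f zero))) (sum-swap (λ i → f (suc i))))
                           (sym (sum-+ (f zero) _))

term≤sum : ∀ {n} (f : Fin n → ℕ) i → f i ≤ sumℕ f
term≤sum f zero    = m≤m+n _ _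
term≤sum f (suc i) = ≤-trans (term≤sum (λ i → f (suc i)) i) (m≤n+m _ (f zero))

sum-pos : ∀ {n} (f : Fin n → ℕ) → 0 < sumℕ f → ∃ λ i → 0 < f i
sum-pos {suc n} f p with f zero in eq
... | suc k = zero , subst (0 <_) (sym eq) (s≤s z≤n)
... | zero with sum-pos (λ i → f (suc i)) p
... | i , q = suc i , q

δ : ∀ {n} → Fin n → Fin n → ℕ
δ i j = if does (i ≟ j) then 1 else 0

sum-*δ : ∀ {n} (f : Fin n → ℕ) i → sumℕ (λ j → f j * δ i j) ≡ f i
sum-*δ {suc n} f zero = trans
  (cong₂ _+_ (*-identityʳ (f zero))
             (trans (sum-cong (λ j → *-zeroʳ (f (suc j)))) (sum-0 n)))
  (+-identityʳ (f zero))
sum-*δ {suc n} f (suc i) = cong₂ _+_ (*-zeroʳ (f zero)) (sum-*δ (λ j → f (suc j)) i)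

sum-δ : ∀ {n} (i : Fin n) → sumℕ (δ i) ≡ 1
sum-δ i = trans (sum-cong (λ j → sym (*-identityˡ (δ i j)))) (sum-*δ (λ _ → 1) i)

sumOver : ∀ {n} → VSet n → (Fin n → ℕ) → ℕ
sumOver A f = sumℕ (λ v → if A v then f v else 0)

if-cong : ∀ b {x y : ℕ} → (b ≡ true → x ≡ y) → (if b then x else 0) ≡ (if b then y else 0)
if-cong true  h = h refl
if-cong false h = refl

if-mono : ∀ b {x y : ℕ} → (b ≡ true → x ≤ y) → (if b then x else 0) ≤ (if b then y else 0)
if-mono true  h = h refl
if-mono false h = z≤n

if≤ : ∀ b (x : ℕ) → (if b then x else 0) ≤ x
if≤ true  x = ≤-refl
if≤ false x = z≤n

if-+ : ∀ b (x y : ℕ) → (if b then x + y else 0) ≡ (if b then x else 0) + (if b then y else 0)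
if-+ true  x y = refl
if-+ false x y = refl

if-sum : ∀ b {n} (f : Fin n → ℕ) → sumℕ (λ j → if b then f j else 0) ≡ (if b then sumℕ f else 0)
if-sum true  f = refl
if-sum false {n} f = sum-0 n

sumOver-mono : ∀ {n} (A : VSet n) {f g : Fin n → ℕ} → (∀ v → A v ≡ true → f v ≤ g v) →
  sumOver A f ≤ sumOver A g
sumOver-mono A h = sum-mono (λ v → if-mono (A v) (h v))

sumOver-+ : ∀ {n} (A : VSet n) (f g : Fin n → ℕ) →
  sumOver A (λ v → f v + g v) ≡ sumOver A f + sumOver A g
sumOver-+ A f g = trans (sum-cong (λ v → if-+ (A v) (f v) (g v)))
  (sum-+ (λ v → if A v then f v else 0) (λ v → if A v then g v else 0))

sumOver≤sum : ∀ {n} (A : VSet n) (f : Fin n → ℕ) → sumOver A f ≤ sumℕ f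
sumOver≤sum A f = sum-mono (λ v → if≤ (A v) (f v))

complement : ∀ {n} → VSet n → VSet n
complement A v = not (A v)

sum-split : ∀ {n} (A : VSet n) (f : Fin n → ℕ) →
  sumℕ f ≡ sumOver A f + sumOver (complement A) f
sum-split A f = trans (sum-cong (λ v → split (A v) (f v)))
  (sum-+ (λ v → if A v then f v else 0) (λ v → if not (A v) then f v else 0))
  where
  split : ∀ b (x : ℕ) → x ≡ (if b then x else 0) + (if not b then x else 0)
  split true  x = sym (+-identityʳ x)
  split false x = refl

row col : ∀ {n} → Mult n → Fin n → ℕ
row m u = sumℕ (m u)
col m v = sumℕ (λ u → m u v)

total : ∀ {n} → Mult n → ℕ
total m = sumℕ (λ u → sumℕ (m u))

restrict : ∀ {n} → VSet n → VSet n → Mult n → Mult n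
restrict A B m u v = if A u then (if B v then m u v else 0) else 0

total-mono : ∀ {n} {l m : Mult n} → (∀ u v → l u v ≤ m u v) → total l ≤ total m
total-mono h = sum-mono (λ u → sum-mono (h u))

total-cong : ∀ {n} {l m : Mult n} → (∀ u v → l u v ≡ m u v) → total l ≡ total m
total-cong h = sum-cong (λ u → sum-cong (h u))

total-+ : ∀ {n} (l m : Mult n) → total (λ u v → l u v + m u v) ≡ total l + total m
total-+ l m = trans (sum-cong (λ u → sum-+ (l u) (m u))) (sum-+ (row l) (row m))

total-rows : ∀ {n} (A : VSet n) (m : Mult n) →
  total (λ u v → if A u then m u v else 0) ≡ sumOver A (row m)
total-rows A m = sum-cong (λ u → if-sum (A u) (m u))

total-cols : ∀ {n} (A : VSet n) (m : Mult n) →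
  total (λ u v → if A v then m u v else 0) ≡ sumOver A (col m)
total-cols A m = trans (sum-swap (λ u v → if A v then m u v else 0)) (total-rows A (flip m))

upper : ∀ {n} → Mult n → Mult n
upper m u v = if toℕ u <ᵇ toℕ v then m u v else 0

-- `delCount` sums over pairs `u < v` and `edgesBetween` over ordered pairs; this converts one into
-- the other. The part of `m` below the diagonal is the transpose of the upper part of `flip m`.
upper-flip : ∀ {n} (m : Mult n) → (∀ v → m v v ≡ 0) →
  total (upper (λ u v → m u v + m v u)) ≡ total m
upper-flip m diag = begin
  total (upper (λ u v → m u v + m v u))
    ≡⟨ total-cong (λ u v → if-+ (toℕ u <ᵇ toℕ v) (m u v) (m v u)) ⟩
  total (λ u v → upper m u v + upper (flip m) u v)
    ≡⟨ total-+ (upper m) (upper (flip m)) ⟩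
  total (upper m) + total (upper (flip m))
    ≡⟨ cong (_+_ (total (upper m))) (sum-swap (upper (flip m))) ⟩
  total (upper m) + total (flip (upper (flip m)))
    ≡⟨ total-+ (upper m) (flip (upper (flip m))) ⟨
  total (λ u v → upper m u v + upper (flip m) v u)
    ≡⟨ total-cong pointwise ⟩
  total m ∎
  where
  open ≡-Reasoning
  pointwise : ∀ u v → upper m u v + upper (flip m) v u ≡ m u v
  pointwise u v with toℕ u <ᵇ toℕ v in p | toℕ v <ᵇ toℕ u in q
  ... | true  | false = +-identityʳ _
  ... | false | true  = refl
  ... | true  | true  = ⊥-elim (<-asym (<ᵇ⇒< (toℕ u) (toℕ v) (subst T (sym p) _))
                                       (<ᵇ⇒< (toℕ v) (toℕ u) (subst T (sym q) _)))
  -- Neither index is smaller, so `u` and `v` coincide and the entry lies on the diagonal.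
  ... | false | false rewrite toℕ-injective {i = u} {j = v}
        (≤-antisym (≮⇒≥ (λ l → subst T q (<⇒<ᵇ l))) (≮⇒≥ (λ l → subst T p (<⇒<ᵇ l)))) = sym (diag v)

subset? : ∀ {n} (A X : VSet n) →
  (∀ v → A v ≡ true → X v ≡ true) ⊎ (∃ λ v → A v ≡ true × X v ≡ false)
subset? A X with any? (λ v → (A v Bool.≟ true) ×-dec (X v Bool.≟ false))
... | yes p = inj₂ p
... | no ¬p = inj₁ (λ v a → ¬-not (λ x → ¬p (v , a , x)))

-- The invariant `X` is handed along the walk. Taking one side of a cut as `X` turns this into a
-- proof that the other side is not reached.
reach-closed : ∀ {n} {A : VSet n} {m : Mult n} (X : VSet n) →
  (∀ {u w} → A w ≡ true → 0 < m u w → X u ≡ true → X w ≡ true) →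
  ∀ {u v} → Reach A m u v → X u ≡ true → X v ≡ true
reach-closed X cl here         x = x
reach-closed X cl (step a p t) x = reach-closed X cl t (cl a p x)

-- Edge cuts

_∩_ _∖_ : ∀ {n} → VSet n → VSet n → VSet n
(A ∩ B) v = A v ∧ B v
(A ∖ B) v = A v ∧ not (B v)

module _ (G : Graph) where
  open Graph G

  private
    joins : VSet n → VSet n → Fin n → Fin n → Bool
    joins A B u v = (A u ∧ B v) ∨ (A v ∧ B u)

    joins≤ : ∀ a b c d (x : ℕ) → (if (a ∧ b) ∨ (c ∧ d) then x else 0)
      ≤ (if a then (if b then x else 0) else 0) + (if c then (if d then x else 0) else 0)
    joins≤ true  true  c     d     x = m≤m+n _ _
    joins≤ true  false true  true  x = ≤-refl
    joins≤ true  false true  false x = z≤n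
    joins≤ true  false false d     x = z≤n
    joins≤ false b     true  true  x = ≤-refl
    joins≤ false b     true  false x = z≤n
    joins≤ false b     false d     x = z≤n

  edgeDeletion : VSet n → VSet n → Deletion G
  edgeDeletion A B = record
    { del     = λ u v → if joins A B u v then mult u v else 0
    ; del-sym = λ u v → cong₂ (λ b x → if b then x else 0)
                  (∨-comm (A u ∧ B v) (A v ∧ B u)) (symmetric u v)
    ; del-≤   = λ u v → if≤ (joins A B u v) (mult u v)
    }

  restrict-loopless : ∀ A B v → restrict A B mult v v ≡ 0
  restrict-loopless A B v with A v | B v
  ... | true  | true  = loopless v
  ... | true  | false = refl
  ... | false | _     = refl

  -- An edge with both ends in `A ∩ B` is deleted once but counted in both directions by
  -- `edgesBetween`, hence an inequality.
  delCount-edgeDeletion : ∀ A B → delCount G (edgeDeletion A B) ≤ edgesBetween G A B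
  delCount-edgeDeletion A B = begin
    delCount G (edgeDeletion A B)
      ≤⟨ total-mono (λ u v → if-mono (toℕ u <ᵇ toℕ v) (λ _ → bound u v)) ⟩
    total (upper (λ u v → restrict A B mult u v + restrict A B mult v u))
      ≡⟨ upper-flip (restrict A B mult) (restrict-loopless A B) ⟩
    edgesBetween G A B ∎
    where
    open ≤-Reasoning
    bound : ∀ u v → (if joins A B u v then mult u v else 0)
      ≤ restrict A B mult u v + restrict A B mult v u
    bound u v = ≤-trans (joins≤ (A u) (B v) (A v) (B u) (mult u v))
      (≤-reflexive (cong (_+_ (restrict A B mult u v))
        (cong (λ x → if A v then (if B u then x else 0) else 0) (symmetric u v))))

  edgeDeletion-removes : ∀ A B u v → A u ≡ true → B v ≡ true →
    remaining G (edgeDeletion A B) u v ≡ 0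
  edgeDeletion-removes A B u v a b rewrite a | b = n∸n≡0 (mult u v)

  -- Each cut edge is oriented out of `X`, so `row` counts at the ends inside and `col` at the ends
  -- outside.
  cut : VSet n → Mult n
  cut X = restrict X (complement X) mult

  -- At most one of the two orientations of a pair leaves `X`, so each pair contributes a single
  -- term, which its deleted edges cover.
  cut≤delCount : ∀ X (d : Deletion G) →
    (∀ u v → X u ≡ true → X v ≡ false → mult u v ≤ Deletion.del d u v) →
    total (cut X) ≤ delCount G d
  cut≤delCount X d h = begin
    total (cut X)
      ≡⟨ upper-flip (cut X) (restrict-loopless X (complement X)) ⟨
    total (upper (λ u v → cut X u v + cut X v u))
      ≤⟨ total-mono (λ u v → if-mono (toℕ u <ᵇ toℕ v) (λ _ → bound u v)) ⟩
    delCount G d ∎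
    where
    open ≤-Reasoning
    open Deletion d
    bound : ∀ u v → cut X u v + cut X v u ≤ del u v
    bound u v with X u in p | X v in q
    ... | true  | true  = z≤n
    ... | true  | false = ≤-trans (≤-reflexive (+-identityʳ _)) (h u v p q)
    ... | false | true  = ≤-trans (h v u q p) (≤-reflexive (del-sym v u))
    ... | false | false = z≤n

  -- If fewer than `r` edges of `A` crossed `X`, deleting them all would stay within the budget
  -- `r ∸ 1` and leave no walk inside `A` from `a` to `b`.
  crossing-edges : ∀ {r} {A : VSet n} (X : VSet n) → 1 ≤ r → REdgeConnected G r A →
    ∀ {a b} → A a ≡ true → X a ≡ true → A b ≡ true → X b ≡ false →
    r ≤ edgesBetween G (A ∩ X) (A ∖ X)
  crossing-edges {r} {A} X 1≤r conn {a} {b} Aa Xa Ab Xb with r ≤? edgesBetween G (A ∩ X) (A ∖ X)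
  ... | yes p = p
  ... | no ¬p = ⊥-elim (true≢false (proj₂ (∧-true {A b} reached)) Xb)
    where
    d = edgeDeletion (A ∩ X) (A ∖ X)
    closed : ∀ {u w} → A w ≡ true → 0 < remaining G d u w →
      (A ∩ X) u ≡ true → (A ∩ X) w ≡ true
    closed {u} {w} Aw pos i = ∧-intro Aw (¬-not λ Xw → n≮0 (subst (0 <_)
      (edgeDeletion-removes (A ∩ X) (A ∖ X) u w i (∧-intro Aw (cong not Xw))) pos))
    reached : (A ∩ X) b ≡ true
    reached = reach-closed (A ∩ X) closed
      (conn d (≤-trans (delCount-edgeDeletion (A ∩ X) (A ∖ X))
                       (suc[m]≤n⇒m≤pred[n] (≰⇒> ¬p))) a b Aa Ab)
      (∧-intro Aa Xa)

-- Brambles and scrambles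

unit : ∀ {n} → Fin n → Fin n → Mult n
unit p q u v = δ p u * δ q v

total-unit : ∀ {n} (p q : Fin n) → total (unit p q) ≡ 1
total-unit p q = trans
  (sum-cong (λ u → trans (sum-cong (λ v → *-comm (δ p u) (δ q v)))
                         (trans (sum-*ʳ (δ q) (δ p u)) (*-comm _ (δ p u)))))
  (trans (sum-*ʳ (δ p) (sumℕ (δ q))) (cong₂ _*_ (sum-δ p) (sum-δ q)))

unit≤ : ∀ {n} (m : Mult n) {p q} → 0 < m p q → ∀ u v → unit p q u v ≤ m u v
unit≤ m {p} {q} pos u v with p ≟ u | q ≟ v
... | yes refl | yes refl = pos
... | yes _    | no _     = z≤n
... | no _     | _        = z≤n

-- Remove edges one at a time while every member of L keeps more than r of them.
thin : ∀ {n} (L : List (VSet n)) (r : ℕ) (c : Mult n) → (∃ λ A → A ∈ L) →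
  (∀ A → A ∈ L → r ≤ sumOver A (row c)) →
  ∃ λ F → (∀ u v → F u v ≤ c u v) × (∀ A → A ∈ L → r ≤ sumOver A (row F))
        × ∃ λ A → A ∈ L × sumOver A (row F) ≤ r
thin {n} L r c (A₀ , A₀∈L) = go (total c) c ≤-refl (λ u v → ≤-refl)
  where
  -- `k` bounds the number of edges left and makes the recursion terminate.
  go : ∀ k F → total F ≤ k → (∀ u v → F u v ≤ c u v) → (∀ A → A ∈ L → r ≤ sumOver A (row F)) →
    ∃ λ F → (∀ u v → F u v ≤ c u v) × (∀ A → A ∈ L → r ≤ sumOver A (row F))
          × ∃ λ A → A ∈ L × sumOver A (row F) ≤ r
  go k F F≤k F≤c cov with Any.any? (λ A → sumOver A (row F) ≤? r) L
  ... | yes tight = F , F≤c , cov , find tight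
  ... | no loose = shrink k F≤k
    where
    exceeds : ∀ A → A ∈ L → r < sumOver A (row F)
    exceeds A A∈L = ≰⇒> (λ le → loose (lose A∈L le))
    -- The member `A₀` still counts more than `r` edges, so there is one to remove.
    total>0 : 0 < total F
    total>0 = ≤-trans (≤-trans (s≤s z≤n) (exceeds A₀ A₀∈L)) (sumOver≤sum A₀ (row F))
    p = proj₁ (sum-pos (row F) total>0)
    edge = sum-pos (F p) (proj₂ (sum-pos (row F) total>0))
    q = proj₁ edge
    F′ : Mult n
    F′ u v = F u v ∸ unit p q u v
    F-split : ∀ u v → F u v ≡ F′ u v + unit p q u v
    F-split u v = sym (m∸n+n≡m (unit≤ F (proj₂ edge) u v))
    total-split : total F ≡ total F′ + 1
    total-split = trans (total-cong F-split)
      (trans (total-+ F′ (unit p q)) (cong (_+_ (total F′)) (total-unit p q)))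
    -- Each member counted more than `r` edges and counts the removed one at most once.
    cov′ : ∀ A → A ∈ L → r ≤ sumOver A (row F′)
    cov′ A A∈L = +-cancelʳ-≤ 1 r _ (begin
      r + 1
        ≡⟨ +-comm r 1 ⟩
      suc r
        ≤⟨ exceeds A A∈L ⟩
      sumOver A (row F)
        ≤⟨ sumOver-mono A (λ u _ → ≤-reflexive
             (trans (sum-cong (F-split u)) (sum-+ (F′ u) (unit p q u)))) ⟩
      sumOver A (λ u → row F′ u + row (unit p q) u)
        ≡⟨ sumOver-+ A (row F′) (row (unit p q)) ⟩
      sumOver A (row F′) + sumOver A (row (unit p q))
        ≤⟨ +-monoʳ-≤ (sumOver A (row F′))
             (≤-trans (sumOver≤sum A (row (unit p q))) (≤-reflexive (total-unit p q))) ⟩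
      sumOver A (row F′) + 1 ∎)
      where open ≤-Reasoning
    shrink : ∀ k → total F ≤ k → _
    shrink zero    le = ⊥-elim (n≮0 (≤-trans total>0 le))
    shrink (suc k) le = go k F′
      (+-cancelʳ-≤ 1 _ k (≤-trans (≤-reflexive (sym total-split)) (≤-trans le (≤-reflexive (+-comm 1 k)))))
      (λ u v → ≤-trans (m∸n≤m (F u v) (unit p q u v)) (F≤c u v)) cov′

reach-trans : ∀ {n} {A : VSet n} {m : Mult n} {u v w} → Reach A m u v → Reach A m v w → Reach A m u w
reach-trans here         q = q
reach-trans (step a p t) q = step a p (reach-trans t q)

-- Vertex sets and minima up to double negation.

¬¬-all-dec : ∀ {n} (P : Fin n → Set) → ¬ ¬ (∀ i → Dec (P i))
¬¬-all-dec {zero}  P k = k (λ ())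
¬¬-all-dec {suc n} P k = ¬¬-excluded-middle λ d →
  ¬¬-all-dec (λ i → P (suc i)) λ ds → k λ { zero → d ; (suc i) → ds i }

-- Turns a component, given by an undecided reachability predicate, into a Boolean vertex set. The
-- double negation does no harm where the final claim is a decidable inequality.
¬¬-characteristic : ∀ {n} (P : Fin n → Set) →
  ¬ ¬ (∃ λ (X : VSet n) → (∀ v → P v → X v ≡ true) × (∀ v → X v ≡ true → P v))
¬¬-characteristic P k = ¬¬-all-dec P λ P? → k
  ( (λ v → does (P? v)) , (λ v p → dec-true (P? v) p) , (λ v → witness (P? v)))
  where
  witness : ∀ {Q : Set} (d : Dec Q) → does d ≡ true → Q
  witness (yes q) _ = q

-- Descent: a value of `P` that is not least has a smaller one below it. This supplies the order of
-- a scramble although the existence of egg cuts is not decided.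
¬¬-least : (P : ℕ → Set) → ∀ {k} → P k → ¬ ¬ (∃ λ m → P m × ∀ j → P j → m ≤ j)
¬¬-least P {k} p no-least = below (suc k) k ≤-refl p
  where
  below : ∀ b j → j < b → P j → ⊥
  below (suc b) j (s≤s j≤b) q = no-least (j , q , λ i pi →
    decidable-stable (j ≤? i) (λ j≰i → below b i (<-≤-trans (≰⇒> j≰i) j≤b) pi))

-- Bramble order against cut size.

module _ (G : Graph) {r : ℕ} (1≤r : 1 ≤ r) where
  open Graph G

  touch-disjoint : ∀ {A B : VSet n} (X : VSet n) → (∀ v → A v ≡ true → X v ≡ true) →
    (∀ v → B v ≡ true → X v ≡ false) → Touch G r A B → r ≤ edgesBetween G A B
  touch-disjoint X A⊆X B⊆Xᶜ (inj₁ (v , a , b)) = ⊥-elim (true≢false (A⊆X v a) (B⊆Xᶜ v b))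
  touch-disjoint X A⊆X B⊆Xᶜ (inj₂ le)          = le

  cut≡mult : ∀ X {u v} → X u ≡ true → X v ≡ false → cut G X u v ≡ mult u v
  cut≡mult X p q rewrite p | q = refl

  -- A member outside X has r edges to E₀, and the outer ends of all of these are counted in C:
  -- in H if the edge is not in F, in K if it is.
  module HittingSet {ℬ : List (VSet n)} (bramble : IsBramble G r ℬ) (X : VSet n)
    (c F : Mult n) (c≡mult : ∀ {u v} → X u ≡ true → X v ≡ false → c u v ≡ mult u v)
    (F≤c : ∀ u v → F u v ≤ c u v)
    (F-covers : ∀ E → E ∈ ℬ → (∀ v → E v ≡ true → X v ≡ true) → r ≤ sumOver E (row F))
    {E₀ : VSet n} (E₀∈ℬ : E₀ ∈ ℬ) (E₀⊆X : ∀ v → E₀ v ≡ true → X v ≡ true)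
    (E₀-tight : sumOver E₀ (row F) ≤ r) where
    open ≤-Reasoning
    private
      eggs  = proj₁ bramble
      touch = proj₂ bramble

    H K : Mult n
    H u v = c u v ∸ F u v
    K u v = if E₀ u then F u v else 0
    C : MSet G
    C w = row F w + col H w + col K w

    -- Every cut edge is counted at exactly one end by `F` or `H`; the remaining term `K` adds at
    -- most `r` because `E₀` is tight.
    size-C : msize G C ≤ total c + r
    size-C = begin
      msize G C
        ≡⟨ sum-+ (λ w → row F w + col H w) (col K) ⟩
      sumℕ (λ w → row F w + col H w) + sumℕ (col K)
        ≡⟨ cong₂ _+_ (trans (sum-+ (row F) (col H)) (cong (_+_ (total F)) (sym (sum-swap H))))
                     (trans (sym (sum-swap K)) (total-rows E₀ F)) ⟩
      total F + total H + sumOver E₀ (row F)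
        ≤⟨ +-mono-≤ (≤-reflexive (trans (sym (total-+ F H))
             (total-cong (λ u v → m+[n∸m]≡n (F≤c u v))))) E₀-tight ⟩
      total c + r ∎

    C-hits : RIntersectsAll G r C ℬ
    C-hits E E∈ with subset? E X
    ... | inj₁ E⊆X = begin
      r                 ≤⟨ F-covers E E∈ E⊆X ⟩
      sumOver E (row F) ≤⟨ sumOver-mono E (λ v _ → ≤-trans (m≤m+n _ _) (m≤m+n _ _)) ⟩
      sumOver E C       ∎
    ... | inj₂ (y , Ey , Xy) with subset? E (complement X)
    -- `E` is split by `X`: it contains both ends of at least `r` cut edges, so the end counted in
    -- `C`, inner for `F` and outer for `H`, always lies in `E`.
    ...   | inj₂ (x , Ex , Xx) = begin
      r
        ≤⟨ crossing-edges G X 1≤r (proj₂ (eggs E E∈)) Ex (not-injective Xx) Ey Xy ⟩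
      edgesBetween G (E ∩ X) (E ∖ X)
        ≤⟨ total-mono bound ⟩
      total (λ u v → (if E u then F u v else 0) + (if E v then H u v else 0))
        ≡⟨ total-+ (λ u v → if E u then F u v else 0) (λ u v → if E v then H u v else 0) ⟩
      total (λ u v → if E u then F u v else 0) + total (λ u v → if E v then H u v else 0)
        ≡⟨ cong₂ _+_ (total-rows E F) (total-cols E H) ⟩
      sumOver E (row F) + sumOver E (col H)
        ≡⟨ sumOver-+ E (row F) (col H) ⟨
      sumOver E (λ w → row F w + col H w)
        ≤⟨ sumOver-mono E (λ v _ → m≤m+n _ _) ⟩
      sumOver E C ∎
      where
      bound : ∀ u v → restrict (E ∩ X) (E ∖ X) mult u v
        ≤ (if E u then F u v else 0) + (if E v then H u v else 0)
      bound u v with E u | E v | X u in p | X v in q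
      ... | true  | true  | true  | false = ≤-reflexive (trans (sym (c≡mult p q)) (sym (m+[n∸m]≡n (F≤c u v))))
      ... | true  | true  | true  | true  = z≤n
      ... | true  | false | true  | _     = z≤n
      ... | true  | _     | false | _     = z≤n
      ... | false | _     | _     | _     = z≤n
    ...   | inj₁ E⊆Xᶜ = begin
      r
        ≤⟨ touch-disjoint X E₀⊆X E-outside (touch E₀ E E₀∈ℬ E∈) ⟩
      edgesBetween G E₀ E
        ≤⟨ total-mono bound ⟩
      total (λ u v → if E v then H u v + K u v else 0)
        ≡⟨ total-cols E (λ u v → H u v + K u v) ⟩
      sumOver E (col (λ u v → H u v + K u v))
        ≤⟨ sumOver-mono E (λ v _ → ≤-trans (≤-reflexive (sum-+ (λ u → H u v) (λ u → K u v)))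
             (+-monoˡ-≤ (col K v) (m≤n+m (col H v) (row F v)))) ⟩
      sumOver E C ∎
      where
      E-outside : ∀ v → E v ≡ true → X v ≡ false
      E-outside v e = not-injective (E⊆Xᶜ v e)
      bound : ∀ u v → restrict E₀ E mult u v ≤ (if E v then H u v + K u v else 0)
      bound u v with E₀ u in p | E v in q
      ... | true  | true  = ≤-reflexive (trans (sym (c≡mult (E₀⊆X u p) (E-outside v q)))
                              (sym (m∸n+n≡m (F≤c u v))))
      ... | true  | false = z≤n
      ... | false | _     = z≤n

  -- Apply `thin` to the members inside `X`. Each of them touches `B`, which lies outside, and
  -- therefore meets at least `r` cut edges; `A` shows that there is such a member.
  bramble-order-cut : ∀ {ℬ b} → IsBramble G r ℬ →
    (∀ C → RIntersectsAll G r C ℬ → b ≤ msize G C) → (X : VSet n) →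
    ∀ {A B} → A ∈ ℬ → B ∈ ℬ →
    (∀ v → A v ≡ true → X v ≡ true) → (∀ v → B v ≡ true → X v ≡ false) →
    b ≤ total (cut G X) + r
  bramble-order-cut {ℬ} {b} bramble hit X {A} {B} A∈ B∈ A⊆X B⊆Xᶜ =
    let F , F≤c , F-covers , E₀ , E₀∈inner , E₀-tight =
          thin (filter inside? ℬ) r (cut G X) (A , ∈-filter⁺ inside? A∈ A⊆X) inner-covered
        E₀∈ℬ , E₀⊆X = ∈-filter⁻ inside? {xs = ℬ} E₀∈inner
        open HittingSet bramble X (cut G X) F (cut≡mult X) F≤c
          (λ E E∈ E⊆X → F-covers E (∈-filter⁺ inside? E∈ E⊆X)) E₀∈ℬ E₀⊆X E₀-tight
    in ≤-trans (hit C C-hits) size-C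
    where
    inside? : ∀ E → Dec (∀ v → E v ≡ true → X v ≡ true)
    inside? E with subset? E X
    ... | inj₁ s           = yes s
    ... | inj₂ (v , e , x) = no (λ s → true≢false (s v e) x)
    inner-covered : ∀ E → E ∈ filter inside? ℬ → r ≤ sumOver E (row (cut G X))
    inner-covered E E∈ = let E∈ℬ , E⊆X = ∈-filter⁻ inside? {xs = ℬ} E∈ in begin
      r
        ≤⟨ touch-disjoint X E⊆X B⊆Xᶜ (proj₂ bramble E B E∈ℬ B∈) ⟩
      edgesBetween G E B
        ≤⟨ total-mono (λ u v → if-mono (E u) (λ e → bound u v (E⊆X u e))) ⟩
      total (λ u v → if E u then cut G X u v else 0)
        ≡⟨ total-rows E (cut G X) ⟩
      sumOver E (row (cut G X)) ∎
      where
      open ≤-Reasoning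
      bound : ∀ u v → X u ≡ true → (if B v then mult u v else 0) ≤ cut G X u v
      bound u v p with B v in q
      ... | true  = ≤-reflexive (sym (cut≡mult X p (B⊆Xᶜ v q)))
      ... | false = z≤n

  remaining-sym : ∀ d u v → remaining G d u v ≡ remaining G d v u
  remaining-sym d u v = cong₂ _∸_ (symmetric u v) (Deletion.del-sym d u v)

  -- Let `X` be the component of `x` after the deletion. It contains `A` and misses `B`, and every
  -- edge leaving it has been deleted, so the bound for the cut around `X` applies.
  bramble-order-eggCut : ∀ {ℬ b} → IsBramble G r ℬ → (∀ C → RIntersectsAll G r C ℬ → b ≤ msize G C) →
    ∀ d → IsEggCut G ℬ d → b ≤ delCount G d + r
  bramble-order-eggCut {ℬ} {b} bramble hit d (A , B , A∈ , B∈ , x , y , Ax , By , A-comp , B-comp , sep) =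
    decidable-stable (b ≤? _) λ k → ¬¬-characteristic (Reach allV (remaining G d) x)
      λ (X , reach⇒X , X⇒reach) → k (
        let
          extend : ∀ {u v} → X u ≡ true → 0 < remaining G d u v → X v ≡ true
          extend {u} {v} Xu pos = reach⇒X v (reach-trans (X⇒reach u Xu) (step refl pos here))
          outside : ∀ v → B v ≡ true → X v ≡ false
          -- The remaining edges are symmetric, so the complement of `X` is closed under
          -- reachability too, and it contains `y`.
          outside v Bv = not-injective (reach-closed (complement X)
            (λ {u} {w} _ pos Xu → cong not (¬-not λ Xw → true≢false
              (extend Xw (subst (0 <_) (remaining-sym d u w) pos)) (not-injective Xu)))
            (B-comp v Bv) (cong not (¬-not (λ Xy → sep (X⇒reach y Xy)))))
          deleted : ∀ u v → X u ≡ true → X v ≡ false → mult u v ≤ Deletion.del d u v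
          deleted u v Xu Xv = m∸n≡0⇒m≤n (n≤0⇒n≡0 (≮⇒≥ (λ pos → true≢false (extend Xu pos) Xv)))
        in ≤-trans
          (bramble-order-cut bramble hit X A∈ B∈ (λ v Av → reach⇒X v (A-comp v Av)) outside)
          (+-monoˡ-≤ r (cut≤delCount G X d deleted)))

  -- The optimal bramble is itself a scramble, of order `m` say. If `m` is the size of a hitting set
  -- then `b ≤ m`; if it is the size of an egg cut then `b ≤ m + r`.
  bn≤sn+r : ∀ {b s} → BnIs G r b → SnIs G r s → b ≤ s + r
  bn≤sn+r {b} {s} ((ℬ , bramble , (C , C-hits , ∣C∣≡b) , hit) , _) (_ , max) =
    decidable-stable (b ≤? s + r) λ k → ¬¬-least Order (inj₁ (C , C-hits , ∣C∣≡b))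
      λ (m , order , least) → k (≤-trans (bound m order)
        (+-monoˡ-≤ r (max ℬ m (proj₁ bramble)
          ( order , (λ C h → least _ (inj₁ (C , h , refl))) , (λ d e → least _ (inj₂ (d , e , refl)))))))
    where
    Order : ℕ → Set
    Order k = (∃ λ C → RIntersectsAll G r C ℬ × msize G C ≡ k)
            ⊎ (∃ λ d → IsEggCut G ℬ d × delCount G d ≡ k)
    bound : ∀ m → Order m → b ≤ m + r
    bound m (inj₁ (C , h , refl)) = ≤-trans (hit C h) (m≤m+n _ r)
    bound m (inj₂ (d , e , refl)) = bramble-order-eggCut bramble hit d e

-- Divisors

sumℤ-+ : ∀ {n} (D : Fin n → ℤ) (a : Fin n → ℕ) →
  sumℤ (λ v → D v ℤ.+ + a v) ≡ sumℤ D ℤ.+ + sumℕ a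
sumℤ-+ {zero}  D a = refl
sumℤ-+ {suc n} D a = trans
  (cong (ℤ._+_ (D zero ℤ.+ + a zero)) (sumℤ-+ (λ i → D (suc i)) (λ i → a (suc i))))
  (regroup (D zero) (+ a zero) _ _)
  where
  regroup : ∀ w x y z → w ℤ.+ x ℤ.+ (y ℤ.+ z) ≡ w ℤ.+ y ℤ.+ (x ℤ.+ z)
  regroup = ℤ-Solver.solve-∀

sumℤ-cong : ∀ {n} {f g : Fin n → ℤ} → (∀ i → f i ≡ g i) → sumℤ f ≡ sumℤ g
sumℤ-cong {zero}  h = refl
sumℤ-cong {suc n} h = cong₂ ℤ._+_ (h zero) (sumℤ-cong (λ i → h (suc i)))

sumℤ-pos : ∀ {n} (f : Fin n → ℕ) → sumℤ (λ i → + f i) ≡ + sumℕ f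
sumℤ-pos {zero}  f = refl
sumℤ-pos {suc n} f = cong (ℤ._+_ (+ f zero)) (sumℤ-pos (λ i → f (suc i)))

-- Descend from `k + t`, where `P` holds: the first failure met is the required `i`, and the descent
-- stops at `t` at the latest.
last-rise : {P : ℕ → Set} → (∀ i → Dec (P i)) → ∀ t k → ¬ P t → P (k + t) →
  ∃ λ i → t ≤ i × ¬ P i × P (suc i)
last-rise P? t zero    ¬p p = ⊥-elim (¬p p)
last-rise P? t (suc k) ¬p p with P? (k + t)
... | yes q = last-rise P? t k ¬p q
... | no ¬q = k + t , m≤n+m t k , ¬q , p

reach-map : ∀ {n} {A : VSet n} {l m : Mult n} →
  (∀ u w → A u ≡ true → A w ≡ true → 0 < l u w → 0 < m u w) →
  ∀ {u v} → A u ≡ true → Reach A l u v → Reach allV m u v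
reach-map h a here         = here
reach-map h a (step b p t) = step refl (h _ _ a b p) (reach-map h b t)

-- Linear equivalence through firing scripts.

module _ (G : Graph) where
  open Graph G

  -- The chips that `w` receives when every `v` fires `f v` times; `val G w * f w` minus this is the
  -- Laplacian of `f` at `w`.
  nbrSum : (Fin n → ℕ) → Fin n → ℕ
  nbrSum f w = sumℕ (λ v → mult w v * f v)

  nbrSum-+ : ∀ f g w → nbrSum (λ v → f v + g v) w ≡ nbrSum f w + nbrSum g w
  nbrSum-+ f g w = trans (sum-cong (λ v → *-distribˡ-+ (mult w v) (f v) (g v)))
                         (sum-+ (λ v → mult w v * f v) _)

  nbrSum-const : ∀ c w → nbrSum (λ _ → c) w ≡ val G w * c
  nbrSum-const c w = sum-*ʳ (mult w) c

  nbrSum-mono : ∀ {f g} w → (∀ v → f v ≤ g v) → nbrSum f w ≤ nbrSum g w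
  nbrSum-mono w h = sum-mono (λ v → *-monoʳ-≤ (mult w v) (h v))

  -- Chips received equal chips sent, by symmetry of `mult`; this is why the degree is invariant.
  sum-nbrSum : ∀ f → sumℕ (nbrSum f) ≡ sumℕ (λ w → val G w * f w)
  sum-nbrSum f = begin
    sumℕ (nbrSum f)
      ≡⟨ sum-swap (λ w v → mult w v * f v) ⟩
    total (λ v w → mult w v * f v)
      ≡⟨ total-cong (λ v w → cong (_* f v) (symmetric w v)) ⟩
    total (λ v w → mult v w * f v)
      ≡⟨ sum-cong (λ v → sum-*ʳ (mult v) (f v)) ⟩
    sumℕ (λ w → val G w * f w) ∎
    where open ≡-Reasoning

  -- f v counts the firings of v. Firing all vertices changes nothing, so natural numbers suffice.
  record Script (f : Fin n → ℕ) (D D′ : Divisor G) : Set where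
    field
      chips : ∀ w → D′ w ℤ.+ + (val G w * f w) ≡ D w ℤ.+ + nbrSum f w
  open Script public

  script-base : ∀ {D D′} → (∀ w → D w ≡ D′ w) → Script (λ _ → 0) D D′
  script-base h .chips w = cong₂ (λ x k → x ℤ.+ + k) (sym (h w)) (sym (nbrSum-const 0 w))

  script-trans : ∀ {f g D D′ D″} → Script f D D′ → Script g D′ D″ → Script (λ v → f v + g v) D D″
  script-trans {f} {g} {D} {D′} {D″} s t .chips w = begin
    D″ w ℤ.+ + (val G w * (f w + g w))
      ≡⟨ cong (λ k → D″ w ℤ.+ + k) (*-distribˡ-+ (val G w) (f w) (g w)) ⟩
    D″ w ℤ.+ (+ (val G w * f w) ℤ.+ + (val G w * g w))
      ≡⟨ swap (D″ w) _ _ ⟩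
    D″ w ℤ.+ + (val G w * g w) ℤ.+ + (val G w * f w)
      ≡⟨ cong (ℤ._+ + (val G w * f w)) (chips t w) ⟩
    D′ w ℤ.+ + nbrSum g w ℤ.+ + (val G w * f w)
      ≡⟨ rotate (D′ w) _ _ ⟩
    D′ w ℤ.+ + (val G w * f w) ℤ.+ + nbrSum g w
      ≡⟨ cong (ℤ._+ + nbrSum g w) (chips s w) ⟩
    D w ℤ.+ + nbrSum f w ℤ.+ + nbrSum g w
      ≡⟨ ℤ.+-assoc (D w) _ _ ⟩
    D w ℤ.+ + (nbrSum f w + nbrSum g w)
      ≡⟨ cong (λ k → D w ℤ.+ + k) (nbrSum-+ f g w) ⟨
    D w ℤ.+ + nbrSum (λ v → f v + g v) w ∎
    where
    open ≡-Reasoning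
    swap : ∀ x y z → x ℤ.+ (y ℤ.+ z) ≡ x ℤ.+ z ℤ.+ y
    swap = ℤ-Solver.solve-∀
    rotate : ∀ x y z → x ℤ.+ y ℤ.+ z ≡ x ℤ.+ z ℤ.+ y
    rotate = ℤ-Solver.solve-∀

  -- The inverse script is `- f`. Adding the constant `sumℕ f` makes it a natural-valued script
  -- without changing its effect.
  script-sym : ∀ {f D D′} → Script f D D′ → Script (λ v → sumℕ f ∸ f v) D′ D
  script-sym {f} {D} {D′} s .chips w = begin
    D w ℤ.+ + a′
      ≡⟨ insert (D w) (+ b) (+ a′) ⟩
    D w ℤ.+ + b ℤ.+ + a′ ℤ.- + b
      ≡⟨ cong (λ x → x ℤ.+ + a′ ℤ.- + b) (sym (chips s w)) ⟩
    D′ w ℤ.+ + a ℤ.+ + a′ ℤ.- + b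
      ≡⟨ cong (ℤ._- + b) (ℤ.+-assoc (D′ w) (+ a) (+ a′)) ⟩
    D′ w ℤ.+ + (a + a′) ℤ.- + b
      ≡⟨ cong (λ k → D′ w ℤ.+ + k ℤ.- + b) balance ⟩
    D′ w ℤ.+ (+ b ℤ.+ + b′) ℤ.- + b
      ≡⟨ delete (D′ w) (+ b) (+ b′) ⟩
    D′ w ℤ.+ + b′ ∎
    where
    open ≡-Reasoning
    f′ : Fin n → ℕ
    f′ v = sumℕ f ∸ f v
    a  = val G w * f w
    a′ = val G w * f′ w
    b  = nbrSum f w
    b′ = nbrSum f′ w
    f+f′ : ∀ v → f v + f′ v ≡ sumℕ f
    f+f′ v = m+[n∸m]≡n (term≤sum f v)
    -- `f` and `f′` add up to a constant, and under a constant script every vertex sends as much as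
    -- it receives.
    balance : a + a′ ≡ b + b′
    balance = begin
      a + a′                         ≡⟨ *-distribˡ-+ (val G w) (f w) (f′ w) ⟨
      val G w * (f w + f′ w)         ≡⟨ cong (val G w *_) (f+f′ w) ⟩
      val G w * sumℕ f               ≡⟨ nbrSum-const (sumℕ f) w ⟨
      nbrSum (λ _ → sumℕ f) w        ≡⟨ sum-cong (λ v → cong (mult w v *_) (sym (f+f′ v))) ⟩
      nbrSum (λ v → f v + f′ v) w    ≡⟨ nbrSum-+ f f′ w ⟩
      b + b′                         ∎
    insert : ∀ x y z → x ℤ.+ z ≡ x ℤ.+ y ℤ.+ z ℤ.- y
    insert = ℤ-Solver.solve-∀
    delete : ∀ x y z → x ℤ.+ (y ℤ.+ z) ℤ.- y ≡ x ℤ.+ z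
    delete = ℤ-Solver.solve-∀

  script-fire : ∀ v D → Script (δ v) D (fire G v D)
  script-fire v D .chips w rewrite sum-*δ (mult w) v with v ≟ w
  ... | yes refl rewrite *-identityʳ (val G v) | loopless v = cancel (D v) (+ val G v)
    where
    cancel : ∀ x y → x ℤ.- y ℤ.+ y ≡ x ℤ.+ + 0
    cancel = ℤ-Solver.solve-∀
  ... | no _ rewrite *-zeroʳ (val G w) | symmetric w v = ℤ.+-identityʳ _

  ∼⇒script : ∀ {D D′} → _∼_ G D D′ → ∃ λ f → Script f D D′
  ∼⇒script (∼base h) = _ , script-base h
  ∼⇒script (∼fire {D'} {D''} v p h) =
    _ , script-trans (proj₂ (∼⇒script p))
          (script-trans (script-fire v D') (script-base (λ w → sym (h w))))
  ∼⇒script (∼unfire {D'} {D''} v p h) =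
    _ , script-trans (script-trans (proj₂ (∼⇒script p)) (script-base h))
          (script-sym (script-fire v D''))
  ∼⇒script (∼trans p q) = _ , script-trans (proj₂ (∼⇒script p)) (proj₂ (∼⇒script q))

  script-deg : ∀ {f D D′} → Script f D D′ → deg G D′ ≡ deg G D
  script-deg {f} {D} {D′} s = ℤ-Group.∙-cancelʳ (+ k) (deg G D′) (deg G D) (begin
    deg G D′ ℤ.+ + k
      ≡⟨ sumℤ-+ D′ (λ w → val G w * f w) ⟨
    sumℤ (λ w → D′ w ℤ.+ + (val G w * f w))
      ≡⟨ sumℤ-cong (chips s) ⟩
    sumℤ (λ w → D w ℤ.+ + nbrSum f w)
      ≡⟨ sumℤ-+ D (nbrSum f) ⟩
    deg G D ℤ.+ + sumℕ (nbrSum f)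
      ≡⟨ cong (λ x → deg G D ℤ.+ + x) (sum-nbrSum f) ⟩
    deg G D ℤ.+ + k ∎)
    where
    open ≡-Reasoning
    k = sumℕ (λ w → val G w * f w)

  -- Firing a vertex set between effective divisors.

  Fires : VSet n → (Fin n → ℕ) → (Fin n → ℕ) → Set
  Fires U X Y = ∀ v → Y v + (if U v then val G v else 0) ≡ X v + sumOver U (mult v)

  -- Firing all vertices does nothing, so firing the complement undoes firing `U`.
  fires-complement : ∀ {U X Y} → Fires U X Y → Fires (complement U) Y X
  fires-complement {U} {X} {Y} h v with U v | h v | sum-split U (mult v)
  ... | true | e | split = trans (+-identityʳ (X v)) (sym (+-cancelʳ-≡ p _ _ (begin
      Y v + q + p     ≡⟨ +-assoc (Y v) q p ⟩
      Y v + (q + p)   ≡⟨ cong (_+_ (Y v)) (trans (+-comm q p) (sym split)) ⟩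
      Y v + val G v   ≡⟨ e ⟩
      X v + p         ∎)))
    where
    open ≡-Reasoning
    p = sumOver U (mult v)
    q = sumOver (complement U) (mult v)
  ... | false | e | split = begin
      X v + val G v   ≡⟨ cong (_+_ (X v)) split ⟩
      X v + (p + q)   ≡⟨ +-assoc (X v) p q ⟨
      X v + p + q     ≡⟨ cong (_+ q) (trans (sym e) (+-identityʳ (Y v))) ⟩
      Y v + q         ∎
    where
    open ≡-Reasoning
    p = sumOver U (mult v)
    q = sumOver (complement U) (mult v)

  module _ {U : VSet n} {X Y : Fin n → ℕ} (fires : Fires U X Y) where

    private
      fired : ∀ {u} → U u ≡ true → Y u + val G u ≡ X u + sumOver U (mult u)
      fired {u} Uu = trans (cong (λ b → Y u + (if b then val G u else 0)) (sym Uu)) (fires u)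

    fires-loses : ∀ {u} → U u ≡ true → Y u ≤ X u
    fires-loses {u} Uu = +-cancelʳ-≤ (val G u) (Y u) (X u)
      (≤-trans (≤-reflexive (fired Uu)) (+-monoʳ-≤ (X u) (sumOver≤sum U (mult u))))

    -- A vertex of `U` sends one chip along each edge leaving `U`; since `Y u` is not negative, it
    -- had that many to start with.
    outflow≤ : ∀ {u} → U u ≡ true → sumOver (complement U) (mult u) ≤ X u
    outflow≤ {u} Uu = +-cancelˡ-≤ (sumOver U (mult u)) _ _ (begin
      sumOver U (mult u) + sumOver (complement U) (mult u)  ≡⟨ sum-split U (mult u) ⟨
      val G u                                               ≤⟨ m≤n+m _ (Y u) ⟩
      Y u + val G u                                         ≡⟨ fired Uu ⟩
      X u + sumOver U (mult u)                              ≡⟨ +-comm (X u) _ ⟩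
      sumOver U (mult u) + X u                              ∎)
      where open ≤-Reasoning

    cut≤sum : edgesBetween G U (complement U) ≤ sumℕ X
    cut≤sum = sum-mono bound
      where
      bound : ∀ u → sumℕ (λ v → if U u then (if complement U v then mult u v else 0) else 0) ≤ X u
      bound u with U u in p
      ... | true  = outflow≤ p
      ... | false = ≤-trans (≤-reflexive (sum-0 n)) z≤n

    module _ {r : ℕ} (1≤r : 1 ≤ r) {A : VSet n} (conn : REdgeConnected G r A) where

      -- At least `r` edges inside `A` leave `U`, and each takes a chip from its end in `A ∩ U`.
      crossing⇒hit : ∀ {a b} → A a ≡ true → U a ≡ true → A b ≡ true → U b ≡ false →
        r ≤ countIn G X A
      crossing⇒hit Aa Ua Ab Ub =
        ≤-trans (crossing-edges G U 1≤r conn Aa Ua Ab Ub) (sum-mono bound)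
        where
        inner : ∀ u v → (if (A ∖ U) v then mult u v else 0) ≤ (if complement U v then mult u v else 0)
        inner u v with A v
        ... | true  = ≤-refl
        ... | false = z≤n
        bound : ∀ u → sumℕ (λ v → if (A ∩ U) u then (if (A ∖ U) v then mult u v else 0) else 0)
          ≤ (if A u then X u else 0)
        bound u with A u | U u in p
        ... | true  | true  = ≤-trans (sum-mono (inner u)) (outflow≤ p)
        ... | true  | false = ≤-trans (≤-reflexive (sum-0 n)) z≤n
        ... | false | _     = ≤-reflexive (sum-0 n)

      -- If `A` lay inside `U` it could only lose chips; if it met both sides it would have been hit
      -- before the firing. So it is disjoint from `U`.
      gain⇒outside : countIn G X A < r → r ≤ countIn G Y A → ∀ v → A v ≡ true → U v ≡ false
      gain⇒outside X<r r≤Y v Av = ¬-not λ Uv → case Uv (subset? A U)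
        where
        case : U v ≡ true → _ → ⊥
        case Uv (inj₁ A⊆U) = <⇒≱ X<r (≤-trans r≤Y (sumOver-mono A (λ u Au → fires-loses (A⊆U u Au))))
        case Uv (inj₂ (w , Aw , Uw)) = <⇒≱ X<r (crossing⇒hit Av Uv Aw Uw)

  -- Read backwards, the loss is a gain under the firing of the complement.
  loss⇒inside : ∀ {U X Y r A} → Fires U X Y → 1 ≤ r → REdgeConnected G r A →
    r ≤ countIn G X A → countIn G Y A < r → ∀ v → A v ≡ true → U v ≡ true
  loss⇒inside fires 1≤r conn r≤X Y<r v Av =
    not-injective (gain⇒outside (fires-complement fires) 1≤r conn Y<r r≤X v Av)

  -- Firing the level sets {F > t} for t = M − 1, …, 0 in turn, where M bounds F, leads from X to
  -- Y through the effective divisors level t.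
  module LevelSets (X Y F : Fin n → ℕ)
    (script : ∀ v → Y v + val G v * F v ≡ X v + nbrSum F v) where

    -- The result of applying the script `F ∸ t` to `X`; by `bounded` the outer subtraction never
    -- truncates.
    level : ℕ → Fin n → ℕ
    level t v = (X v + nbrSum (λ w → F w ∸ t) v) ∸ val G v * (F v ∸ t)

    superlevel : ℕ → VSet n
    superlevel t v = t <ᵇ F v

    private
      -- If `F v < t` the left side vanishes. Otherwise `F w ≤ t + (F w ∸ t)` for every `w` and the
      -- constant `t` has no effect, so `v` keeps at least `Y v` chips.
      bounded : ∀ t v → val G v * (F v ∸ t) ≤ X v + nbrSum (λ w → F w ∸ t) v
      bounded t v with t ≤? F v
      ... | no ¬le = ≤-trans (≤-reflexive (trans
              (cong (val G v *_) (m≤n⇒m∸n≡0 (≰⇒≥ ¬le))) (*-zeroʳ (val G v)))) z≤n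
      ... | yes le = +-cancelˡ-≤ (val G v * t) _ _ (begin
        val G v * t + val G v * (F v ∸ t)
          ≡⟨ *-distribˡ-+ (val G v) t (F v ∸ t) ⟨
        val G v * (t + (F v ∸ t))
          ≡⟨ cong (val G v *_) (m+[n∸m]≡n le) ⟩
        val G v * F v
          ≤⟨ m≤n+m _ (Y v) ⟩
        Y v + val G v * F v
          ≡⟨ script v ⟩
        X v + nbrSum F v
          ≤⟨ +-monoʳ-≤ (X v) (nbrSum-mono v (λ w → m≤n+m∸n (F w) t)) ⟩
        X v + nbrSum (λ w → t + (F w ∸ t)) v
          ≡⟨ cong (_+_ (X v)) (trans (nbrSum-+ (λ _ → t) (λ w → F w ∸ t) v)
                                  (cong (_+ nbrSum (λ w → F w ∸ t) v) (nbrSum-const t v))) ⟩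
        X v + (val G v * t + nbrSum (λ w → F w ∸ t) v)
          ≡⟨ x∙yz≈y∙xz (X v) (val G v * t) _ ⟩
        val G v * t + (X v + nbrSum (λ w → F w ∸ t) v) ∎)
        where open ≤-Reasoning

    level-script : ∀ t v → level t v + val G v * (F v ∸ t) ≡ X v + nbrSum (λ w → F w ∸ t) v
    level-script t v = m∸n+n≡m (bounded t v)

    level-0 : ∀ v → level 0 v ≡ Y v
    level-0 v = +-cancelʳ-≡ (val G v * F v) _ _ (trans (level-script 0 v) (sym (script v)))

    level-top : ∀ M → (∀ v → F v ≤ M) → ∀ v → level M v ≡ X v
    level-top M F≤M v = begin
      level M v                                      ≡⟨ +-identityʳ _ ⟨
      level M v + 0                                  ≡⟨ cong (_+_ (level M v)) (*-zeroʳ (val G v)) ⟨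
      level M v + val G v * 0                        ≡⟨ cong (λ k → level M v + val G v * k) (flat v) ⟨
      level M v + val G v * (F v ∸ M)                ≡⟨ level-script M v ⟩
      X v + nbrSum (λ w → F w ∸ M) v                 ≡⟨ cong (_+_ (X v)) (sum-cong (λ w → cong (mult v w *_) (flat w))) ⟩
      X v + nbrSum (λ _ → 0) v                       ≡⟨ cong (_+_ (X v)) (trans (nbrSum-const 0 v) (*-zeroʳ (val G v))) ⟩
      X v + 0                                        ≡⟨ +-identityʳ _ ⟩
      X v                                            ∎
      where
      open ≡-Reasoning
      flat : ∀ w → F w ∸ M ≡ 0
      flat w = m≤n⇒m∸n≡0 (F≤M w)

    level-fires : ∀ t → Fires (superlevel t) (level (suc t)) (level t)
    level-fires t v = +-cancelʳ-≡ (val G v * (F v ∸ suc t)) _ _ (begin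
      level t v + (if U v then val G v else 0) + val G v * (F v ∸ suc t)
        ≡⟨ trans (+-assoc (level t v) _ _) (cong (_+_ (level t v)) (slope (val G v) v)) ⟩
      level t v + val G v * (F v ∸ t)
        ≡⟨ level-script t v ⟩
      X v + nbrSum (λ w → F w ∸ t) v
        ≡⟨ cong (_+_ (X v)) (trans (sum-cong (λ w → sym (slope (mult v w) w)))
                                (sum-+ (λ w → if U w then mult v w else 0) (λ w → mult v w * (F w ∸ suc t)))) ⟩
      X v + (sumOver U (mult v) + nbrSum (λ w → F w ∸ suc t) v)
        ≡⟨ x∙yz≈xz∙y (X v) (sumOver U (mult v)) _ ⟩
      X v + nbrSum (λ w → F w ∸ suc t) v + sumOver U (mult v)
        ≡⟨ cong (_+ sumOver U (mult v)) (level-script (suc t) v) ⟨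
      level (suc t) v + val G v * (F v ∸ suc t) + sumOver U (mult v)
        ≡⟨ xy∙z≈xz∙y (level (suc t) v) _ (sumOver U (mult v)) ⟩
      level (suc t) v + sumOver U (mult v) + val G v * (F v ∸ suc t) ∎)
      where
      open ≡-Reasoning
      U = superlevel t
      -- Passing from `suc t` to `t` raises `F w ∸ t` by one exactly on the superlevel set.
      slope : ∀ c w → (if U w then c else 0) + c * (F w ∸ suc t) ≡ c * (F w ∸ t)
      slope c w with t <? F w
      ... | yes t<F rewrite dec-true (t <? F w) t<F =
            trans (sym (*-suc c _)) (cong (c *_) (sym (+-∸-assoc 1 t<F)))
      ... | no t≮F rewrite dec-false (t <? F w) t≮F =
            cong (c *_) (trans (m≤n⇒m∸n≡0 (m≤n⇒m≤1+n (≮⇒≥ t≮F))) (sym (m≤n⇒m∸n≡0 (≮⇒≥ t≮F))))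

    superlevel-antitone : ∀ {t i} → t ≤ i → ∀ v → superlevel i v ≡ true → superlevel t v ≡ true
    superlevel-antitone t≤i v p =
      dec-true (_ <? F v) (≤-<-trans t≤i (<ᵇ⇒< _ (F v) (subst T (sym p) _)))

    private
      M = sumℕ F

      count-cong : ∀ {P Q : Fin n → ℕ} B → (∀ v → P v ≡ Q v) → countIn G P B ≡ countIn G Q B
      count-cong B h = sum-cong (λ v → if-cong (B v) (λ _ → h v))

      count-top : ∀ B → countIn G (level M) B ≡ countIn G X B
      count-top B = count-cong B (level-top M (term≤sum F))

    -- Time runs downwards in `t`, from `X` at level `M` to `Y` at level `0`; the gain is thus a
    -- rise in `t` of the property of being below `r`.
    level-gain : ∀ {r A} → countIn G X A < r → r ≤ countIn G Y A →
      ∃ λ t → t < M × countIn G (level (suc t)) A < r × r ≤ countIn G (level t) A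
    level-gain {r} {A} X<r r≤Y
      with last-rise (λ t → countIn G (level t) A <? r) 0 M
             (≤⇒≯ (subst (r ≤_) (sym (count-cong A level-0)) r≤Y))
             (subst (λ k → countIn G (level k) A < r) (sym (+-identityʳ M))
               (subst (_< r) (sym (count-top A)) X<r))
    ... | t , _ , t≮r , suc-t<r = t , t<M , suc-t<r , ≮⇒≥ t≮r
      where
      t<M : t < M
      t<M = ≰⇒> λ M≤t → <⇒≱ X<r (subst (r ≤_)
        (count-cong A (level-top t (λ v → ≤-trans (term≤sum F v) M≤t))) (≮⇒≥ t≮r))

    -- `B` is hit at level `M` and no longer at level `t`, so the loss occurs at some `i` with
    -- `t ≤ i`, where the fired set is contained in the one fired at `t`.
    level-loss : ∀ {r B t} → t < M → r ≤ countIn G X B → countIn G (level t) B < r →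
      ∃ λ i → t ≤ i × r ≤ countIn G (level (suc i)) B × countIn G (level i) B < r
    level-loss {r} {B} {t} t<M r≤X t<r
      with last-rise (λ i → r ≤? countIn G (level i) B) t (M ∸ t) (<⇒≱ t<r)
             (subst (λ k → r ≤ countIn G (level k) B) (sym (m∸n+n≡m (<⇒≤ t<M)))
               (subst (r ≤_) (sym (count-top B)) r≤X))
    ... | i , t≤i , i≱r , r≤suc-i = i , t≤i , r≤suc-i , ≰⇒> i≱r

  -- With nothing deleted, edge-connectivity gives a walk inside `A`, and `d` spares all edges of
  -- `A`.
  connected-inside : ∀ {r A} → REdgeConnected G r A → (d : Deletion G) →
    (∀ u w → A u ≡ true → A w ≡ true → remaining G d u w ≡ mult u w) →
    ∀ {a} → A a ≡ true → ∀ x → A x ≡ true → Reach allV (remaining G d) a x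
  connected-inside {r} conn d keeps {a} Aa x Ax =
    reach-map (λ u w Au Aw → subst (0 <_) (sym (keeps u w Au Aw))) Aa
      (conn (edgeDeletion G ∅ ∅) none a x Aa Ax)
    where
    ∅ : VSet n
    ∅ _ = false
    none : delCount G (edgeDeletion G ∅ ∅) ≤ r ∸ 1
    none = ≤-trans (delCount-edgeDeletion G ∅ ∅)
      (≤-trans (≤-reflexive (trans (sum-cong {n} (λ _ → sum-0 n)) (sum-0 n))) z≤n)

  -- Only edges across `U` are deleted, so each egg stays within one component, while no walk leaves
  -- `U`.
  separated⇒eggCut : ∀ {r S} → IsScramble G r S → (U : VSet n) →
    ∀ {A B} → A ∈ S → B ∈ S →
    (∀ v → A v ≡ true → U v ≡ true) → (∀ v → B v ≡ true → U v ≡ false) →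
    IsEggCut G S (edgeDeletion G U (complement U))
  separated⇒eggCut {r} {S} scramble U {A} {B} A∈ B∈ A⊆U B⊆Uᶜ
    with scramble A A∈ | scramble B B∈
  ... | (a , Aa) , A-conn | (b , Bb) , B-conn =
    A , B , A∈ , B∈ , a , b , Aa , Bb
    , connected-inside {r} A-conn d (λ u w Au Aw → keeps u w (trans (A⊆U u Au) (sym (A⊆U w Aw)))) Aa
    , connected-inside {r} B-conn d (λ u w Bu Bw → keeps u w (trans (B⊆Uᶜ u Bu) (sym (B⊆Uᶜ w Bw)))) Bb
    , λ reach → true≢false (reach-closed U closed reach (A⊆U a Aa)) (B⊆Uᶜ b Bb)
    where
    d = edgeDeletion G U (complement U)
    keeps : ∀ u w → U u ≡ U w → remaining G d u w ≡ mult u w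
    keeps u w e with U u | U w
    ... | true  | true  = refl
    ... | false | false = refl
    closed : ∀ {u w} → allV w ≡ true → 0 < remaining G d u w → U u ≡ true → U w ≡ true
    closed {u} {w} _ pos Uu = ¬-not λ Uw → n≮0 (subst (0 <_)
      (edgeDeletion-removes G U (complement U) u w Uu (cong not Uw)) pos)

  -- Moving an effective divisor until it hits every egg.

  effective⇒ℕ : ∀ {D} → Effective G D → ∃ λ (X : Fin n → ℕ) → ∀ v → D v ≡ + X v
  effective⇒ℕ {D} eff = (λ v → ℤ.∣ D v ∣) , (λ v → sym (ℤ.0≤i⇒+∣i∣≡i (eff v)))

  module Chase {r : ℕ} (1≤r : 1 ≤ r) {S : List (VSet n)} {s : ℕ} (scramble : IsScramble G r S)
    (cuts : ∀ d → IsEggCut G S d → s ≤ delCount G d) {D : Divisor G} where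

    InClass : (Fin n → ℕ) → Set
    InClass X = ∃ λ f → Script f D (λ v → + X v)

    deg-class : ∀ {X} → InClass X → + sumℕ X ≡ deg G D
    deg-class {X} (f , script) = trans (sym (sumℤ-pos X)) (script-deg script)

    -- Place all `k` chips of `E` on one vertex of `A`, move `D - E` to an effective divisor, and
    -- add `E` back: that vertex then carries at least `k` chips.
    class-hitting : ∀ {k A} → r ≤ k → RankProperty G D k → NonemptySet G A →
      ∃ λ Y → InClass Y × r ≤ countIn G Y A
    class-hitting {k} {A} r≤k rank (v , Av) with rank E sum-E
      where
      E : Fin n → ℕ
      E w = k * δ v w
      sum-E : sumℕ E ≡ k
      sum-E = sum-*δ (λ _ → k) v
    ... | D₁ , eff , equiv with effective⇒ℕ eff | ∼⇒script equiv
    ...   | Z , D₁≡Z | f , script = Y , (f , script-Y) , ≤-trans r≤k k≤Y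
      where
      Y : Fin n → ℕ
      Y w = k * δ v w + Z w
      script-Y : Script f D (λ w → + Y w)
      script-Y .chips w = begin
        + (k * δ v w) ℤ.+ + Z w ℤ.+ + (val G w * f w)
          ≡⟨ ℤ.+-assoc (+ (k * δ v w)) (+ Z w) (+ (val G w * f w)) ⟩
        + (k * δ v w) ℤ.+ (+ Z w ℤ.+ + (val G w * f w))
          ≡⟨ cong (λ x → + (k * δ v w) ℤ.+ (x ℤ.+ + (val G w * f w))) (D₁≡Z w) ⟨
        + (k * δ v w) ℤ.+ (D₁ w ℤ.+ + (val G w * f w))
          ≡⟨ cong (ℤ._+_ (+ (k * δ v w))) (chips script w) ⟩
        + (k * δ v w) ℤ.+ (D w ℤ.- + (k * δ v w) ℤ.+ + nbrSum f w)
          ≡⟨ cancel (+ (k * δ v w)) (D w) (+ nbrSum f w) ⟩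
        D w ℤ.+ + nbrSum f w ∎
        where
        open ≡-Reasoning
        cancel : ∀ x y z → x ℤ.+ (y ℤ.- x ℤ.+ z) ≡ y ℤ.+ z
        cancel = ℤ-Solver.solve-∀
      k≤Y : k ≤ countIn G Y A
      k≤Y = begin
        k                                     ≡⟨ sum-*δ (λ _ → k) v ⟨
        sumℕ (λ w → k * δ v w)                ≤⟨ sum-mono bound ⟩
        countIn G Y A                         ∎
        where
        open ≤-Reasoning
        bound : ∀ w → k * δ v w ≤ (if A w then Y w else 0)
        bound w with v ≟ w
        ... | yes refl rewrite Av = m≤m+n _ _
        ... | no _     = ≤-trans (≤-reflexive (*-zeroʳ k)) z≤n

    class-script : ∀ {X Y} → InClass X → InClass Y →
      ∃ λ F → ∀ v → Y v + val G v * F v ≡ X v + nbrSum F v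
    class-script (f , s₁) (g , s₂) = _ , λ v → ℤ.+-injective (chips (script-trans (script-sym s₁) s₂) v)

    Hits : (Fin n → ℕ) → List (VSet n) → Set
    Hits X L = ∀ B → B ∈ L → r ≤ countIn G X B

    hits-∷ : ∀ {X A L} → r ≤ countIn G X A → Hits X L → Hits X (A ∷ L)
    hits-∷ r≤A hits B (here refl) = r≤A
    hits-∷ r≤A hits B (there B∈)  = hits B B∈

    -- Take the step at which A becomes hit. An egg B hit by X but no longer hit then was lost at
    -- an earlier step, so the set fired there contains B. Being smaller than the set U fired when
    -- A becomes hit, it puts B inside U and A outside, and the cut around U has at most as many
    -- edges as the divisor has chips.
    improve : ∀ {X Y L A} → (∀ B → B ∈ L → B ∈ S) → A ∈ S → InClass X → InClass Y →
      Hits X L → countIn G X A < r → r ≤ countIn G Y A →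
      + s ≤ℤ deg G D ⊎ ∃ λ Z → InClass Z × r ≤ countIn G Z A × Hits Z L
    improve {X} {Y} {L} {A} L⊆S A∈ X∈ Y∈ X-hits X<r r≤Y = via-script (class-script X∈ Y∈)
      where
      Goal = + s ≤ℤ deg G D ⊎ ∃ λ Z → InClass Z × r ≤ countIn G Z A × Hits Z L

      module _ (F : Fin n → ℕ) (script : ∀ v → Y v + val G v * F v ≡ X v + nbrSum F v) where
        open LevelSets X Y F script

        level∈ : ∀ t → InClass (level t)
        level∈ t = _ , script-trans (proj₂ X∈) (record { chips = λ v → cong +_ (level-script t v) })

        separate : ∀ {t B} → B ∈ L → t < sumℕ F → countIn G (level (suc t)) A < r →
          r ≤ countIn G (level t) A → countIn G (level t) B < r → + s ≤ℤ deg G D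
        separate {t} {B} B∈ t<M suc-t<r r≤t B<r with level-loss t<M (X-hits B B∈) B<r
        ... | i , t≤i , hit , lost =
          -- The divisor just before `U` fires bounds the cut, and it has the degree of `D`.
          subst (+ s ≤ℤ_) (deg-class (level∈ (suc t))) (ℤ.+≤+ (begin
            s
              ≤⟨ cuts (edgeDeletion G U (complement U)) (separated⇒eggCut {r} scramble U (L⊆S B B∈) A∈ inside outside) ⟩
            delCount G (edgeDeletion G U (complement U))
              ≤⟨ delCount-edgeDeletion G U (complement U) ⟩
            edgesBetween G U (complement U)
              ≤⟨ cut≤sum (level-fires t) ⟩
            sumℕ (level (suc t)) ∎))
          where
          open ≤-Reasoning
          U = superlevel t
          outside : ∀ v → A v ≡ true → U v ≡ false
          outside = gain⇒outside (level-fires t) 1≤r (proj₂ (scramble A A∈)) suc-t<r r≤t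
          inside : ∀ v → B v ≡ true → U v ≡ true
          inside v Bv = superlevel-antitone t≤i v
            (loss⇒inside (level-fires i) 1≤r (proj₂ (scramble B (L⊆S B B∈))) hit lost v Bv)

        at-level : (∃ λ t → t < sumℕ F × countIn G (level (suc t)) A < r × r ≤ countIn G (level t) A) → Goal
        at-level (t , t<M , suc-t<r , r≤t) with Any.any? (λ B → countIn G (level t) B <? r) L
        ... | no none = inj₂ (level t , level∈ t , r≤t , λ B B∈ → ≮⇒≥ (λ lt → none (lose B∈ lt)))
        ... | yes lost = let B , B∈ , B<r = find lost in inj₁ (separate B∈ t<M suc-t<r r≤t B<r)

      via-script : (∃ λ F → ∀ v → Y v + val G v * F v ≡ X v + nbrSum F v) → Goal
      via-script (F , script) = at-level F script (LevelSets.level-gain X Y F script X<r r≤Y)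

    -- The eggs are taken one at a time: `improve` either yields the degree bound or hits the new
    -- egg while keeping all earlier ones hit.
    hit-all : ∀ {k} → r ≤ k → RankProperty G D k → ∃ InClass → ∀ L → (∀ B → B ∈ L → B ∈ S) →
      + s ≤ℤ deg G D ⊎ ∃ λ Z → InClass Z × Hits Z L
    hit-all r≤k rank (X₀ , X₀∈) [] L⊆S = inj₂ (X₀ , X₀∈ , λ B ())
    hit-all r≤k rank start (A ∷ L) L⊆S = extend (hit-all r≤k rank start L L⊆S′)
      where
      L⊆S′ : ∀ B → B ∈ L → B ∈ S
      L⊆S′ B B∈ = L⊆S B (there B∈)
      A∈ : A ∈ S
      A∈ = L⊆S A (here refl)
      extend : + s ≤ℤ deg G D ⊎ (∃ λ Z → InClass Z × Hits Z L) →
        + s ≤ℤ deg G D ⊎ ∃ λ Z → InClass Z × Hits Z (A ∷ L)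
      extend (inj₁ done) = inj₁ done
      extend (inj₂ (X , X∈ , X-hits)) with r ≤? countIn G X A
      ... | yes r≤X = inj₂ (X , X∈ , hits-∷ {X} r≤X X-hits)
      ... | no X≱r =
        let Y , Y∈ , r≤Y = class-hitting {A = A} r≤k rank (proj₁ (scramble A A∈))
        in map₂ (λ (Z , Z∈ , r≤Z , Z-hits) → Z , Z∈ , hits-∷ {Z} r≤Z Z-hits)
             (improve {X} {Y} {L} {A} L⊆S′ A∈ X∈ Y∈ X-hits (≰⇒> X≱r) r≤Y)

  scrambleOrder≤deg : ∀ {r S s D} → 1 ≤ r → IsScramble G r S → ScrambleOrderIs G r S s →
    RankAtLeast G D r → + s ≤ℤ deg G D
  scrambleOrder≤deg {r} {S} {s} {D} 1≤r scramble (_ , hits , cuts) ((D₀ , eff , equiv) , k , r≤k , rank) =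
    conclude (hit-all r≤k rank start S (λ _ B∈ → B∈))
    where
    open Chase 1≤r {S} {s} scramble cuts {D}
    start : ∃ InClass
    start = let X , D₀≡X = effective⇒ℕ eff ; f , script = ∼⇒script equiv in
      X , _ , script-trans script (script-base D₀≡X)
    conclude : + s ≤ℤ deg G D ⊎ (∃ λ Z → InClass Z × Hits Z S) → + s ≤ℤ deg G D
    conclude (inj₁ done)               = done
    -- With every egg hit, `Z` is itself an `r`-intersecting multiset whose size is the degree of
    -- `D`.
    conclude (inj₂ (Z , Z∈ , Z-hits)) = subst (+ s ≤ℤ_) (deg-class {Z} Z∈) (ℤ.+≤+ (hits Z Z-hits))

theorem5p4 : (G : Graph) (r : ℕ) → 1 ≤ r →
    (b s : ℕ) (g : ℤ) → BnIs G r b → SnIs G r s → GonIs G r g →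
    ((+ b) - (+ r)) ≤ℤ (+ s) × (+ s) ≤ℤ g
theorem5p4 G r 1≤r b s g bn sn@((S , scramble , order) , _) ((D , rank , deg≡g) , _) =
    subst ((+ b) - (+ r) ≤ℤ_) (cancel (+ s) (+ r))
      (ℤ.+-monoˡ-≤ (ℤ.- + r) (ℤ.+≤+ (bn≤sn+r G 1≤r bn sn)))
  , subst (+ s ≤ℤ_) deg≡g (scrambleOrder≤deg G 1≤r scramble order rank)
  where
  cancel : ∀ x y → x ℤ.+ y - y ≡ x
  cancel = ℤ-Solver.solve-∀
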